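{- Let $k,n\in\mathbb{N}$. Then $$S(n+k,n)=\sum_{r=1}^k\binom{k-n}{k-r}\binom{k+n}{k+r}S(k+r,r)$$ and $$s(n+k,n)=\sum_{r=1}^k\binom{k-n}{k-r}\binom{k+n}{k+r}s(k+r,r).$$
   Context: $\mathbb{N}$ is the set of positive integers. For $n\in\mathbb{N}$ and $k\in\{0,1,\ldots,n\}$, the unsigned Stirling number of the first kind $s(n,k)$ and the Stirling number of the second kind $S(n,k)$ are defined by $$x(x-1)\cdots(x-n+1)=\sum_{k=0}^n(-1)^{n-k}s(n,k)x^k,\qquad x^n=\sum_{k=0}^nS(n,k)\,x(x-1)\cdots(x-k+1).$$ Binomial coefficients are generalized: for any number $z$ and integer $j\ge 0$, $\binom{z}{j}=\frac{z(z-1)\cdots(z-j+1)}{j!}$ (with $\binom z0=1$); in particular the upper entry may be negative. -}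

module Defs where

open import Data.Fin.Base using (Fin; zero; suc; toℕ)
open import Data.Fin.Properties using (toℕ<n)
open import Data.Integer.Base using (+_)
open import Data.Nat.Base as ℕ using (ℕ; zero; suc; _∸_; _!; NonZero; s≤s; z≤n)
open import Data.Nat.Properties as ℕ using (_!≢0)
open import Data.Product.Base using (∃-syntax; _,_)
open import Data.Rational.Base using (ℚ; 0ℚ; 1ℚ; _+_; _*_; _-_; -_; _/_)
open import Data.Rational.Properties using (+-*-rawSemiring; +-*-commutativeRing; +-identityˡ; +-identityʳ; *-zeroˡ; *-zeroʳ; *-identityʳ)
open import Data.Rational.Solver using (module +-*-Solver)
open import Algebra.Bundles using (CommutativeRing)
open import Relation.Binary.PropositionalEquality

open import Algebra.Definitions.RawSemiring +-*-rawSemiring public using (_^_)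
open import Algebra.Properties.Semiring.Sum (CommutativeRing.semiring +-*-commutativeRing) public using (sum; sum-syntax; sum⁺-syntax; *-distribˡ-sum; *-distribʳ-sum; ∑-distrib-+; sum-cong-≗)

fromℕ : ℕ → ℚ
fromℕ n = + n / 1

-- x (x - 1) ⋯ (x - n + 1)
falling : ℚ → ℕ → ℚ
falling x zero    = 1ℚ
falling x (suc n) = falling x n * (x - fromℕ n)

-- Unlike Data.Nat.Combinatorics._C_, the upper entry is an arbitrary rational.
binom : ℚ → ℕ → ℚ
binom z j = falling z j * (+ 1 / (j !))
  where instance _ = j !≢0

-- The Stirling numbers are the coefficients in the identities below, in which
-- ∑[ k ≤ n ] ranges over Fin (suc n), that is over k = 0 , … , n.  An identity
-- between polynomials over ℚ is stated as equality at every rational x; as ℚ is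
-- infinite, it determines the values at all (n , k) with n ≥ 1 and k ≤ n.  The
-- values at other (n , k) are left unconstrained.
IsStirling₁ : (ℕ → ℕ → ℚ) → Set
IsStirling₁ s = ∀ n .{{_ : NonZero n}} x →
  falling x n ≡ ∑[ k ≤ n ] ((- 1ℚ) ^ (n ∸ toℕ k) * s n (toℕ k) * x ^ toℕ k)

IsStirling₂ : (ℕ → ℕ → ℚ) → Set
IsStirling₂ S = ∀ n .{{_ : NonZero n}} x →
  x ^ n ≡ ∑[ k ≤ n ] (S n (toℕ k) * falling x (toℕ k))

-- Both predicates are inhabited, so hypotheses of these forms are not vacuous.
-- The witnesses are given by the usual triangular recurrences.

private
  open ≡-Reasoning
  open +-*-Solver

  sum-shift : ∀ (g : ℕ → ℚ) n →
    ∑[ k < n ] g (toℕ k) + g n ≡ g 0 + ∑[ k < n ] g (suc (toℕ k))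
  sum-shift g zero    = trans (+-identityˡ (g 0)) (sym (+-identityʳ (g 0)))
  sum-shift g (suc n) = begin
    g 0 + ∑[ k < n ] g (suc (toℕ k)) + g (suc n)
      ≡⟨ CommutativeRing.+-assoc +-*-commutativeRing (g 0) _ _ ⟩
    g 0 + (∑[ k < n ] g (suc (toℕ k)) + g (suc n))
      ≡⟨ cong (_+_ (g 0)) (sum-shift (λ k → g (suc k)) n) ⟩
    g 0 + (g 1 + ∑[ k < n ] g (suc (suc (toℕ k)))) ∎

  sum-telescope : ∀ (f g : ℕ → ℚ) n → g (suc n) ≡ 0ℚ →
    ∑[ k ≤ n ] (f (toℕ k) + g (toℕ k)) ≡
    g 0 + ∑[ k ≤ n ] (f (toℕ k) + g (suc (toℕ k)))
  sum-telescope f g n g≡0 = begin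
    ∑[ k ≤ n ] (f (toℕ k) + g (toℕ k))
      ≡⟨ ∑-distrib-+ {suc n} (λ k → f (toℕ k)) (λ k → g (toℕ k)) ⟩
    F + G
      ≡⟨ cong (_+_ F) (sym (+-identityʳ G)) ⟩
    F + (G + 0ℚ)
      ≡⟨ cong (λ z → F + (G + z)) (sym g≡0) ⟩
    F + (G + g (suc n))
      ≡⟨ cong (_+_ F) (sum-shift g (suc n)) ⟩
    F + (g 0 + G⁺)
      ≡⟨ solve 3 (λ a b c → a :+ (b :+ c) := b :+ (a :+ c)) refl F (g 0) G⁺ ⟩
    g 0 + (F + G⁺)
      ≡⟨ cong (_+_ (g 0)) (sym (∑-distrib-+ {suc n} (λ k → f (toℕ k)) (λ k → g (suc (toℕ k))))) ⟩
    g 0 + ∑[ k ≤ n ] (f (toℕ k) + g (suc (toℕ k))) ∎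
    where
    F  = ∑[ k ≤ n ] f (toℕ k)
    G  = ∑[ k ≤ n ] g (toℕ k)
    G⁺ = ∑[ k ≤ n ] g (suc (toℕ k))

  rec₁ rec₂ : ℕ → ℕ → ℚ

  rec₁ zero    zero    = 1ℚ
  rec₁ zero    (suc k) = 0ℚ
  rec₁ (suc n) zero    = fromℕ n * rec₁ n zero
  rec₁ (suc n) (suc k) = rec₁ n k + fromℕ n * rec₁ n (suc k)

  rec₂ zero    zero    = 1ℚ
  rec₂ zero    (suc k) = 0ℚ
  rec₂ (suc n) zero    = 0ℚ
  rec₂ (suc n) (suc k) = rec₂ n k + fromℕ (suc k) * rec₂ n (suc k)

  rec₁-above : ∀ {n k} → n ℕ.< k → rec₁ n k ≡ 0ℚ
  rec₁-above {zero}  {suc k} _         = refl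
  rec₁-above {suc n} {suc k} (s≤s n<k)
    rewrite rec₁-above n<k | rec₁-above (ℕ.m<n⇒m<1+n n<k) =
      trans (+-identityˡ _) (*-zeroʳ (fromℕ n))

  rec₂-above : ∀ {n k} → n ℕ.< k → rec₂ n k ≡ 0ℚ
  rec₂-above {zero}  {suc k} _         = refl
  rec₂-above {suc n} {suc k} (s≤s n<k)
    rewrite rec₂-above n<k | rec₂-above (ℕ.m<n⇒m<1+n n<k) =
      trans (+-identityˡ _) (*-zeroʳ (fromℕ (suc k)))

  rec₁-identity : ∀ n x →
    falling x n ≡ ∑[ k ≤ n ] ((- 1ℚ) ^ (n ∸ toℕ k) * rec₁ n (toℕ k) * x ^ toℕ k)
  rec₁-identity zero    x = refl
  rec₁-identity (suc n) x = begin
    falling x n * (x - fromℕ n)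
      ≡⟨ cong (_* (x - fromℕ n)) (rec₁-identity n x) ⟩
    sum t * (x - fromℕ n)
      ≡⟨ *-distribʳ-sum {suc n} (x - fromℕ n) t ⟩
    ∑[ k ≤ n ] (t k * (x - fromℕ n))
      ≡⟨ sum-cong-≗ {suc n} split ⟩
    ∑[ k ≤ n ] (f (toℕ k) + g (toℕ k))
      ≡⟨ sum-telescope f g n g-above ⟩
    g 0 + ∑[ k ≤ n ] (f (toℕ k) + g (suc (toℕ k)))
      ≡⟨ cong (_+_ (g 0)) (sum-cong-≗ {suc n} (λ k → join (toℕ k))) ⟩
    ∑[ k ≤ suc n ] ((- 1ℚ) ^ (suc n ∸ toℕ k) * rec₁ (suc n) (toℕ k) * x ^ toℕ k) ∎
    where
    t : Fin (suc n) → ℚ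
    t k = (- 1ℚ) ^ (n ∸ toℕ k) * rec₁ n (toℕ k) * x ^ toℕ k

    f g : ℕ → ℚ
    f k = (- 1ℚ) ^ (n ∸ k) * rec₁ n k * (x * x ^ k)
    g k = (- 1ℚ) ^ (suc n ∸ k) * (fromℕ n * rec₁ n k) * x ^ k

    g-above : g (suc n) ≡ 0ℚ
    g-above rewrite rec₁-above (ℕ.n<1+n n) | *-zeroʳ (fromℕ n)
      | *-zeroʳ ((- 1ℚ) ^ (n ∸ n)) = *-zeroˡ (x ^ suc n)

    split : ∀ k → t k * (x - fromℕ n) ≡ f (toℕ k) + g (toℕ k)
    split k rewrite ℕ.+-∸-assoc 1 (ℕ.s≤s⁻¹ (toℕ<n k)) =
      solve 5 (λ e a p y m → e :* a :* p :* (y :- m) :=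
                 e :* a :* (y :* p) :+ (:- con 1ℚ) :* e :* (m :* a) :* p) refl
        ((- 1ℚ) ^ (n ∸ toℕ k)) (rec₁ n (toℕ k)) (x ^ toℕ k) x (fromℕ n)

    join : ∀ k → f k + g (suc k) ≡ (- 1ℚ) ^ (n ∸ k) * rec₁ (suc n) (suc k) * x ^ suc k
    join k = solve 4 (λ e a b p → e :* a :* p :+ e :* b :* p := e :* (a :+ b) :* p) refl
      ((- 1ℚ) ^ (n ∸ k)) (rec₁ n k) (fromℕ n * rec₁ n (suc k)) (x ^ suc k)

  rec₂-identity : ∀ n x → x ^ n ≡ ∑[ k ≤ n ] (rec₂ n (toℕ k) * falling x (toℕ k))
  rec₂-identity zero    x = refl
  rec₂-identity (suc n) x = begin
    x * x ^ n
      ≡⟨ cong (x *_) (rec₂-identity n x) ⟩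
    x * sum t
      ≡⟨ *-distribˡ-sum {suc n} x t ⟩
    ∑[ k ≤ n ] (x * t k)
      ≡⟨ sum-cong-≗ {suc n} (λ k → split (toℕ k)) ⟩
    ∑[ k ≤ n ] (f (toℕ k) + g (toℕ k))
      ≡⟨ sum-telescope f g n g-above ⟩
    g 0 + ∑[ k ≤ n ] (f (toℕ k) + g (suc (toℕ k)))
      ≡⟨ cong₂ _+_ g-zero (sum-cong-≗ {suc n} (λ k → join (toℕ k))) ⟩
    ∑[ k ≤ suc n ] (rec₂ (suc n) (toℕ k) * falling x (toℕ k)) ∎
    where
    t : Fin (suc n) → ℚ
    t k = rec₂ n (toℕ k) * falling x (toℕ k)

    f g : ℕ → ℚ
    f k = rec₂ n k * falling x (suc k)
    g k = fromℕ k * rec₂ n k * falling x k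

    g-zero : g 0 ≡ 0ℚ * 1ℚ
    g-zero = cong (_* 1ℚ) (*-zeroˡ (rec₂ n 0))

    g-above : g (suc n) ≡ 0ℚ
    g-above rewrite rec₂-above (ℕ.n<1+n n) | *-zeroʳ (fromℕ (suc n)) =
      *-zeroˡ (falling x (suc n))

    split : ∀ k → x * (rec₂ n k * falling x k) ≡ f k + g k
    split k = solve 4 (λ y a p m → y :* (a :* p) := a :* (p :* (y :- m)) :+ m :* a :* p) refl
      x (rec₂ n k) (falling x k) (fromℕ k)

    join : ∀ k → f k + g (suc k) ≡ rec₂ (suc n) (suc k) * falling x (suc k)
    join k = sym (CommutativeRing.distribʳ +-*-commutativeRing (falling x (suc k))
      (rec₂ n k) (fromℕ (suc k) * rec₂ n (suc k)))

stirling₁-exists : ∃[ s ] IsStirling₁ s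
stirling₁-exists = rec₁ , λ n x → rec₁-identity n x

stirling₂-exists : ∃[ S ] IsStirling₂ S
stirling₂-exists = rec₂ , λ n x → rec₂-identity n x

{-# OPTIONS --safe #-}

-- The recurrences of the Stirling numbers show that S (n + k) n = ∑ⱼ aⱼ binom (n + k) (k + j),
-- with j = 0 , … , k and coefficients aⱼ independent of n, and likewise for s.  So it
-- suffices to prove the identity with binom (n + k) (k + j) in place of S (n + k) n.  There
-- trinomial revision
--   binom (k + n) (k + r) binom (k + r) (k + j) = binom (k + n) (k + j) binom (n - j) (r - j)
-- reduces it to the Vandermonde convolution of binom (k - n) and binom (n - j), whose
-- value is binom (k - j) (k - j) = 1.
module Submission where

open import Algebra.Bundles using (CommutativeRing)
open import Data.Fin.Base using (toℕ)
open import Data.Fin.Properties using (toℕ<n)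
import Data.Integer.Base as ℤ
import Data.Integer.Properties as ℤ
open import Data.Nat.Base using (ℕ; zero; suc; _+_; _∸_; _≤_; _<_; _!; NonZero; z≤n; s≤s; s≤s⁻¹)
import Data.Nat.Base as ℕ
import Data.Nat.Properties as ℕ
open import Data.Product.Base using (_×_; _,_; proj₁; proj₂; ∃-syntax)
open import Data.Rational.Base using (ℚ; 0ℚ; 1ℚ; _*_; _-_; -_; _/_)
import Data.Rational.Base as ℚ
import Data.Rational.Properties as ℚ
open import Data.Rational.Solver using (module +-*-Solver)
import Data.Rational.Unnormalised.Base as ℚᵘ
import Data.Rational.Unnormalised.Properties as ℚᵘ
open import Data.Sum.Base using (inj₁; inj₂)
open import Relation.Binary.PropositionalEquality
open import Defs

open import Algebra.Properties.CommutativeMonoid.Sum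
  (CommutativeRing.+-commutativeMonoid ℚ.+-*-commutativeRing) using (∑-comm)
open import Algebra.Properties.CommutativeSemiring.Exp
  (CommutativeRing.commutativeSemiring ℚ.+-*-commutativeRing) using (^-distrib-*)
open import Algebra.Properties.Group ℚ.+-0-group
  renaming (∙-cancelˡ to +-cancelˡ; ∙-cancelʳ to +-cancelʳ) using ()

open ≡-Reasoning
open +-*-Solver using (solve; _:=_; _:+_; _:*_; _:-_; con)

-- Natural numbers inside the rationals, and cancellation.

fromℚᵘ-homo-+ : ∀ p q → ℚ.fromℚᵘ (p ℚᵘ.+ q) ≡ ℚ.fromℚᵘ p ℚ.+ ℚ.fromℚᵘ q
fromℚᵘ-homo-+ p q = ℚ.toℚᵘ-injective (ℚᵘ.≃-trans (ℚ.toℚᵘ-fromℚᵘ (p ℚᵘ.+ q)) (ℚᵘ.≃-sym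
  (ℚᵘ.≃-trans (ℚ.toℚᵘ-homo-+ (ℚ.fromℚᵘ p) (ℚ.fromℚᵘ q))
    (ℚᵘ.+-cong (ℚ.toℚᵘ-fromℚᵘ p) (ℚ.toℚᵘ-fromℚᵘ q)))))

fromℚᵘ-homo-* : ∀ p q → ℚ.fromℚᵘ (p ℚᵘ.* q) ≡ ℚ.fromℚᵘ p * ℚ.fromℚᵘ q
fromℚᵘ-homo-* p q = ℚ.toℚᵘ-injective (ℚᵘ.≃-trans (ℚ.toℚᵘ-fromℚᵘ (p ℚᵘ.* q)) (ℚᵘ.≃-sym
  (ℚᵘ.≃-trans (ℚ.toℚᵘ-homo-* (ℚ.fromℚᵘ p) (ℚ.fromℚᵘ q))
    (ℚᵘ.*-cong (ℚ.toℚᵘ-fromℚᵘ p) (ℚ.toℚᵘ-fromℚᵘ q)))))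

fromℕ-homo-+ : ∀ m n → fromℕ (m + n) ≡ fromℕ m ℚ.+ fromℕ n
fromℕ-homo-+ m n = trans
  -- The unnormalised sum has numerator `m * 1 + n * 1`, the factors 1 being the denominators of the
  -- other summand.
  (cong (_/ 1) (sym (cong₂ ℤ._+_ (ℤ.*-identityʳ (ℤ.+ m)) (ℤ.*-identityʳ (ℤ.+ n)))))
  (fromℚᵘ-homo-+ (ℚᵘ.mkℚᵘ (ℤ.+ m) 0) (ℚᵘ.mkℚᵘ (ℤ.+ n) 0))

fromℕ-homo-* : ∀ m n → fromℕ (m ℕ.* n) ≡ fromℕ m * fromℕ n
fromℕ-homo-* m n = trans (cong (_/ 1) (ℤ.pos-* m n))
  (fromℚᵘ-homo-* (ℚᵘ.mkℚᵘ (ℤ.+ m) 0) (ℚᵘ.mkℚᵘ (ℤ.+ n) 0))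

fromℕ-inverseʳ : ∀ n .{{_ : NonZero n}} → fromℕ n * (ℤ.+ 1 / n) ≡ 1ℚ
fromℕ-inverseʳ n@(suc n-1) = trans (sym (fromℚᵘ-homo-* p (ℚᵘ.1/ p)))
  (ℚ.fromℚᵘ-cong (ℚᵘ.*-inverseʳ p))
  where p = ℚᵘ.mkℚᵘ (ℤ.+ n) 0

fromℕ≢0 : ∀ n .{{_ : NonZero n}} → fromℕ n ≢ 0ℚ
fromℕ≢0 n n≡0 = ℚ.1≢0 (begin
  1ℚ                       ≡⟨ fromℕ-inverseʳ n ⟨
  fromℕ n * (ℤ.+ 1 / n)    ≡⟨ cong (_* (ℤ.+ 1 / n)) n≡0 ⟩
  0ℚ * (ℤ.+ 1 / n)         ≡⟨ ℚ.*-zeroˡ (ℤ.+ 1 / n) ⟩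
  0ℚ                       ∎)

*-cancelˡ-≢0 : ∀ {p q r} → p ≢ 0ℚ → p * q ≡ p * r → q ≡ r
*-cancelˡ-≢0 {p} {q} {r} p≢0 pq≡pr = begin
  q                ≡⟨ undo q ⟨
  ℚ.1/ p * (p * q) ≡⟨ cong (ℚ.1/ p *_) pq≡pr ⟩
  ℚ.1/ p * (p * r) ≡⟨ undo r ⟩
  r                ∎
  where
  instance _ = ℚ.≢-nonZero p≢0
  undo : ∀ x → ℚ.1/ p * (p * x) ≡ x
  undo x = begin
    ℚ.1/ p * (p * x) ≡⟨ ℚ.*-assoc (ℚ.1/ p) p x ⟨
    ℚ.1/ p * p * x   ≡⟨ cong (_* x) (ℚ.*-inverseˡ p) ⟩
    1ℚ * x           ≡⟨ ℚ.*-identityˡ x ⟩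
    x                ∎

^-≢0 : ∀ {p} → p ≢ 0ℚ → ∀ n → p ^ n ≢ 0ℚ
^-≢0 p≢0 zero    = ℚ.1≢0
^-≢0 {p} p≢0 (suc n) pⁿ⁺¹≡0 =
  ^-≢0 p≢0 n (*-cancelˡ-≢0 p≢0 (trans pⁿ⁺¹≡0 (sym (ℚ.*-zeroʳ p))))

-- Finite sums

sum-cong-< : ∀ {f g : ℕ → ℚ} n → (∀ i → i < n → f i ≡ g i) →
  ∑[ i < n ] f (toℕ i) ≡ ∑[ i < n ] g (toℕ i)
sum-cong-< n f≗g = sum-cong-≗ {n} (λ i → f≗g (toℕ i) (toℕ<n i))

sum-zero : ∀ {f : ℕ → ℚ} n → (∀ i → i < n → f i ≡ 0ℚ) → ∑[ i < n ] f (toℕ i) ≡ 0ℚ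
sum-zero zero    f≗0 = refl
sum-zero (suc n) f≗0 =
  cong₂ ℚ._+_ (f≗0 0 (s≤s z≤n)) (sum-zero n (λ i i<n → f≗0 (suc i) (s≤s i<n)))

sum-drop : ∀ (f : ℕ → ℚ) m n → (∀ i → i < m → f i ≡ 0ℚ) →
  ∑[ i < m + n ] f (toℕ i) ≡ ∑[ i < n ] f (m + toℕ i)
sum-drop f zero    n f≗0 = refl
sum-drop f (suc m) n f≗0 = trans
  (cong₂ ℚ._+_ (f≗0 0 (s≤s z≤n))
    (sum-drop (λ i → f (suc i)) m n (λ i i<m → f≗0 (suc i) (s≤s i<m))))
  (ℚ.+-identityˡ _)

sum-snoc : ∀ (f : ℕ → ℚ) n → ∑[ i ≤ n ] f (toℕ i) ≡ ∑[ i < n ] f (toℕ i) ℚ.+ f n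
sum-snoc f zero    = trans (ℚ.+-identityʳ (f 0)) (sym (ℚ.+-identityˡ (f 0)))
sum-snoc f (suc n) = trans (cong (f 0 ℚ.+_) (sum-snoc (λ i → f (suc i)) n))
  (sym (ℚ.+-assoc (f 0) _ (f (suc n))))

-- The reindexing behind the inductions on sums below: each term of an old sum is split into `f i`
-- and `g i`, and moving `g` by one index puts together the two contributions to the same new term.
sum-shift : ∀ (f g : ℕ → ℚ) n → g (suc n) ≡ 0ℚ →
  ∑[ i ≤ n ] (f (toℕ i) ℚ.+ g (toℕ i)) ≡
  g 0 ℚ.+ ∑[ i ≤ n ] (f (toℕ i) ℚ.+ g (suc (toℕ i)))
sum-shift f g n g≡0 = begin
  ∑[ i ≤ n ] (f (toℕ i) ℚ.+ g (toℕ i))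
    ≡⟨ ∑-distrib-+ {suc n} (λ i → f (toℕ i)) (λ i → g (toℕ i)) ⟩
  F ℚ.+ G
    ≡⟨ cong (F ℚ.+_) (trans (sym (ℚ.+-identityʳ G)) (cong (G ℚ.+_) (sym g≡0))) ⟩
  F ℚ.+ (G ℚ.+ g (suc n))
    ≡⟨ cong (F ℚ.+_) (sum-snoc g (suc n)) ⟨
  F ℚ.+ (g 0 ℚ.+ G⁺)
    ≡⟨ solve 3 (λ a b c → a :+ (b :+ c) := b :+ (a :+ c)) refl F (g 0) G⁺ ⟩
  g 0 ℚ.+ (F ℚ.+ G⁺)
    ≡⟨ cong (g 0 ℚ.+_) (∑-distrib-+ {suc n} (λ i → f (toℕ i)) (λ i → g (suc (toℕ i)))) ⟨
  g 0 ℚ.+ ∑[ i ≤ n ] (f (toℕ i) ℚ.+ g (suc (toℕ i))) ∎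
  where
  F  = ∑[ i ≤ n ] f (toℕ i)
  G  = ∑[ i ≤ n ] g (toℕ i)
  G⁺ = ∑[ i ≤ n ] g (suc (toℕ i))

-- Binomial coefficients with rational upper entry

-- The ratio of consecutive coefficients, free of division; the identities below use it in place of
-- factorials.
binom-suc : ∀ z j → fromℕ (suc j) * binom z (suc j) ≡ (z - fromℕ j) * binom z j
binom-suc z j = begin
  -- The inserted 1 is `j !` times its inverse: `suc j` and `j !` then combine to `suc j !`, which
  -- cancels `v`.
  a * (u * d * v)               ≡⟨ ℚ.*-identityʳ (a * (u * d * v)) ⟨
  a * (u * d * v) * 1ℚ          ≡⟨ cong (a * (u * d * v) *_) (fromℕ-inverseʳ (j !)) ⟨
  a * (u * d * v) * (b * c)
    ≡⟨ solve 6 (λ a u d v b c → a :* (u :* d :* v) :* (b :* c) := u :* d :* c :* (a :* b :* v))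
         refl a u d v b c ⟩
  u * d * c * (a * b * v)
    ≡⟨ cong (λ e → u * d * c * (e * v)) (fromℕ-homo-* (suc j) (j !)) ⟨
  u * d * c * (fromℕ (suc j !) * v)
    ≡⟨ cong (u * d * c *_) (fromℕ-inverseʳ (suc j !)) ⟩
  u * d * c * 1ℚ
    ≡⟨ solve 3 (λ u d c → u :* d :* c :* con 1ℚ := d :* (u :* c)) refl u d c ⟩
  d * (u * c) ∎
  where
  instance
    _ = j ℕ.!≢0
    _ = suc j ℕ.!≢0
  a = fromℕ (suc j)
  b = fromℕ (j !)
  c = ℤ.+ 1 / (j !)
  u = falling z j
  d = z - fromℕ j
  v = ℤ.+ 1 / (suc j !)

fromℕ-cancelˡ : ∀ j {p q} → fromℕ (suc j) * p ≡ fromℕ (suc j) * q → p ≡ q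
fromℕ-cancelˡ j = *-cancelˡ-≢0 (fromℕ≢0 (suc j))

-- The product contains the factor `fromℕ m - fromℕ m`.
falling-above : ∀ {m j} → m < j → falling (fromℕ m) j ≡ 0ℚ
falling-above {m} {suc j} m<1+j with ℕ.m≤n⇒m<n∨m≡n (s≤s⁻¹ m<1+j)
... | inj₁ m<j  = trans (cong (_* (fromℕ m - fromℕ j)) (falling-above m<j)) (ℚ.*-zeroˡ (fromℕ m - fromℕ j))
... | inj₂ refl = trans (cong (falling (fromℕ m) m *_) (ℚ.+-inverseʳ (fromℕ m))) (ℚ.*-zeroʳ (falling (fromℕ m) m))

binom-above : ∀ {m j} → m < j → binom (fromℕ m) j ≡ 0ℚ
binom-above {m} {j} m<j = trans (cong (_* (ℤ.+ 1 / (j !))) (falling-above m<j)) (ℚ.*-zeroˡ (ℤ.+ 1 / (j !)))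
  where instance _ = j ℕ.!≢0

-- The upper entry is an arbitrary rational, so the induction is on the lower one: multiplication by
-- the lower entry and `binom-suc` on both sides leave a polynomial identity.
binom-pascal : ∀ z j → binom (1ℚ ℚ.+ z) (suc j) ≡ binom z j ℚ.+ binom z (suc j)
binom-pascal z zero = fromℕ-cancelˡ 0 (begin
  1ℚ * binom (1ℚ ℚ.+ z) 1       ≡⟨ binom-suc (1ℚ ℚ.+ z) 0 ⟩
  (1ℚ ℚ.+ z - 0ℚ) * 1ℚ          ≡⟨ solve 1 (λ z → (con 1ℚ :+ z :- con 0ℚ) :* con 1ℚ :=
                                            con 1ℚ :+ (z :- con 0ℚ) :* con 1ℚ) refl z ⟩
  1ℚ ℚ.+ (z - 0ℚ) * 1ℚ          ≡⟨ cong (1ℚ ℚ.+_) (binom-suc z 0) ⟨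
  1ℚ ℚ.+ 1ℚ * binom z 1         ≡⟨ ℚ.*-distribˡ-+ 1ℚ 1ℚ (binom z 1) ⟨
  1ℚ * (1ℚ ℚ.+ binom z 1)       ∎)
binom-pascal z (suc j) = fromℕ-cancelˡ (suc j) (begin
  b₂ * binom (1ℚ ℚ.+ z) (suc (suc j))
    ≡⟨ binom-suc (1ℚ ℚ.+ z) (suc j) ⟩
  (1ℚ ℚ.+ z - b₁) * binom (1ℚ ℚ.+ z) (suc j)
    ≡⟨ cong₂ (λ p q → (1ℚ ℚ.+ z - p) * q) (fromℕ-homo-+ 1 j) (binom-pascal z j) ⟩
  (1ℚ ℚ.+ z - (1ℚ ℚ.+ b₀)) * (u ℚ.+ v)
    ≡⟨ solve 4 (λ z b u v → (con 1ℚ :+ z :- (con 1ℚ :+ b)) :* (u :+ v) :=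
                 (z :- b) :* u :+ (z :- b) :* v) refl z b₀ u v ⟩
  (z - b₀) * u ℚ.+ (z - b₀) * v
    ≡⟨ cong (ℚ._+ (z - b₀) * v) (binom-suc z j) ⟨
  b₁ * v ℚ.+ (z - b₀) * v
    ≡⟨ cong (λ p → p * v ℚ.+ (z - b₀) * v) (fromℕ-homo-+ 1 j) ⟩
  (1ℚ ℚ.+ b₀) * v ℚ.+ (z - b₀) * v
    ≡⟨ solve 3 (λ z b v → (con 1ℚ :+ b) :* v :+ (z :- b) :* v :=
                 (con 1ℚ :+ (con 1ℚ :+ b)) :* v :+ (z :- (con 1ℚ :+ b)) :* v) refl z b₀ v ⟩
  (1ℚ ℚ.+ (1ℚ ℚ.+ b₀)) * v ℚ.+ (z - (1ℚ ℚ.+ b₀)) * v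
    ≡⟨ cong₂ (λ p q → p * v ℚ.+ (z - q) * v)
         (trans (cong (1ℚ ℚ.+_) (sym (fromℕ-homo-+ 1 j))) (sym (fromℕ-homo-+ 1 (suc j))))
         (sym (fromℕ-homo-+ 1 j)) ⟩
  b₂ * v ℚ.+ (z - b₁) * v
    ≡⟨ cong (b₂ * v ℚ.+_) (binom-suc z (suc j)) ⟨
  b₂ * v ℚ.+ b₂ * binom z (suc (suc j))
    ≡⟨ ℚ.*-distribˡ-+ b₂ v (binom z (suc (suc j))) ⟨
  b₂ * (v ℚ.+ binom z (suc (suc j))) ∎)
  where
  b₀ = fromℕ j
  b₁ = fromℕ (suc j)
  b₂ = fromℕ (suc (suc j))
  u = binom z j
  v = binom z (suc j)

binom-diag : ∀ m → binom (fromℕ m) m ≡ 1ℚ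
binom-diag zero    = refl
binom-diag (suc m) = begin
  binom (fromℕ (suc m)) (suc m)                  ≡⟨ cong (λ p → binom p (suc m)) (fromℕ-homo-+ 1 m) ⟩
  binom (1ℚ ℚ.+ fromℕ m) (suc m)                 ≡⟨ binom-pascal (fromℕ m) m ⟩
  binom (fromℕ m) m ℚ.+ binom (fromℕ m) (suc m)  ≡⟨ cong₂ ℚ._+_ (binom-diag m) (binom-above (ℕ.n<1+n m)) ⟩
  1ℚ                                             ∎

-- Absorption in a form without division, so that `1 + z = j` needs no separate case.
binom-absorb : ∀ z j → (1ℚ ℚ.+ z - fromℕ j) * binom (1ℚ ℚ.+ z) j ≡ (1ℚ ℚ.+ z) * binom z j
binom-absorb z zero    = cong (_* 1ℚ) (ℚ.+-identityʳ (1ℚ ℚ.+ z))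
binom-absorb z (suc j) = begin
  (1ℚ ℚ.+ z - fromℕ (suc j)) * binom (1ℚ ℚ.+ z) (suc j)
    ≡⟨ cong₂ (λ p q → (1ℚ ℚ.+ z - p) * q) (fromℕ-homo-+ 1 j) (binom-pascal z j) ⟩
  (1ℚ ℚ.+ z - (1ℚ ℚ.+ b)) * (u ℚ.+ v)
    ≡⟨ solve 4 (λ z b u v → (con 1ℚ :+ z :- (con 1ℚ :+ b)) :* (u :+ v) :=
                 (z :- b) :* u :+ (z :- b) :* v) refl z b u v ⟩
  (z - b) * u ℚ.+ (z - b) * v
    ≡⟨ cong (ℚ._+ (z - b) * v) (binom-suc z j) ⟨
  fromℕ (suc j) * v ℚ.+ (z - b) * v
    ≡⟨ cong (λ p → p * v ℚ.+ (z - b) * v) (fromℕ-homo-+ 1 j) ⟩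
  (1ℚ ℚ.+ b) * v ℚ.+ (z - b) * v
    ≡⟨ solve 3 (λ z b v → (con 1ℚ :+ b) :* v :+ (z :- b) :* v := (con 1ℚ :+ z) :* v) refl z b v ⟩
  (1ℚ ℚ.+ z) * v ∎
  where
  b = fromℕ j
  u = binom z j
  v = binom z (suc j)

-- Trinomial revision, by induction on `i`. The factor `suc i` equals `1 + N - m`, so absorption in
-- the second binomial trades it for `suc N`; `binom-suc` in the first turns this into `z - N`, that
-- is `(z - m) - i`, the factor by which the right side grows.
binom-trinomial : ∀ z m i →
  binom z (m + i) * binom (fromℕ (m + i)) m ≡ binom z m * binom (z - fromℕ m) i
binom-trinomial z m zero rewrite ℕ.+-identityʳ m = cong (binom z m *_) (binom-diag m)
binom-trinomial z m (suc i) = fromℕ-cancelˡ i (begin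
  i₁ * (binom z (m + suc i) * binom (fromℕ (m + suc i)) m)
    ≡⟨ cong (λ k → i₁ * (binom z k * binom (fromℕ k) m)) (ℕ.+-suc m i) ⟩
  i₁ * (binom z (suc N) * binom (fromℕ (suc N)) m)
    ≡⟨ cong₂ (λ p q → p * (binom z (suc N) * binom q m)) i₁≡ (fromℕ-homo-+ 1 N) ⟩
  (1ℚ ℚ.+ fromℕ N - fromℕ m) * (binom z (suc N) * binom (1ℚ ℚ.+ fromℕ N) m)
    ≡⟨ solve 3 (λ a b c → a :* (b :* c) := b :* (a :* c)) refl
         (1ℚ ℚ.+ fromℕ N - fromℕ m) (binom z (suc N)) (binom (1ℚ ℚ.+ fromℕ N) m) ⟩
  binom z (suc N) * ((1ℚ ℚ.+ fromℕ N - fromℕ m) * binom (1ℚ ℚ.+ fromℕ N) m)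
    ≡⟨ cong (binom z (suc N) *_) (binom-absorb (fromℕ N) m) ⟩
  binom z (suc N) * ((1ℚ ℚ.+ fromℕ N) * binom (fromℕ N) m)
    ≡⟨ cong (λ p → binom z (suc N) * (p * binom (fromℕ N) m)) (fromℕ-homo-+ 1 N) ⟨
  binom z (suc N) * (fromℕ (suc N) * binom (fromℕ N) m)
    ≡⟨ solve 3 (λ a b c → a :* (b :* c) := (b :* a) :* c) refl
         (binom z (suc N)) (fromℕ (suc N)) (binom (fromℕ N) m) ⟩
  (fromℕ (suc N) * binom z (suc N)) * binom (fromℕ N) m
    ≡⟨ cong (_* binom (fromℕ N) m) (binom-suc z N) ⟩
  (z - fromℕ N) * binom z N * binom (fromℕ N) m
    ≡⟨ ℚ.*-assoc (z - fromℕ N) (binom z N) (binom (fromℕ N) m) ⟩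
  (z - fromℕ N) * (binom z N * binom (fromℕ N) m)
    ≡⟨ cong₂ (λ p q → (z - p) * q) (fromℕ-homo-+ m i) (binom-trinomial z m i) ⟩
  (z - (fromℕ m ℚ.+ fromℕ i)) * (binom z m * binom (z - fromℕ m) i)
    ≡⟨ solve 5 (λ z m i b c → (z :- (m :+ i)) :* (b :* c) := b :* ((z :- m :- i) :* c)) refl
         z (fromℕ m) (fromℕ i) (binom z m) (binom (z - fromℕ m) i) ⟩
  binom z m * ((z - fromℕ m - fromℕ i) * binom (z - fromℕ m) i)
    ≡⟨ cong (binom z m *_) (binom-suc (z - fromℕ m) i) ⟨
  binom z m * (i₁ * binom (z - fromℕ m) (suc i))
    ≡⟨ solve 3 (λ a b c → a :* (b :* c) := b :* (a :* c)) refl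
         (binom z m) i₁ (binom (z - fromℕ m) (suc i)) ⟩
  i₁ * (binom z m * binom (z - fromℕ m) (suc i)) ∎)
  where
  N = m + i
  i₁ = fromℕ (suc i)
  i₁≡ : i₁ ≡ 1ℚ ℚ.+ fromℕ N - fromℕ m
  i₁≡ = begin
    i₁                                          ≡⟨ fromℕ-homo-+ 1 i ⟩
    1ℚ ℚ.+ fromℕ i
      ≡⟨ solve 2 (λ m i → con 1ℚ :+ i := con 1ℚ :+ (m :+ i) :- m) refl (fromℕ m) (fromℕ i) ⟩
    1ℚ ℚ.+ (fromℕ m ℚ.+ fromℕ i) - fromℕ m      ≡⟨ cong (λ p → 1ℚ ℚ.+ p - fromℕ m) (fromℕ-homo-+ m i) ⟨
    1ℚ ℚ.+ fromℕ N - fromℕ m                    ∎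

-- Induction on `m` after multiplication by `suc m`. The weight `x + y - m` is
-- `(x - (m - i)) + (y - i)`, and each summand raises one of the two lower entries. A product with
-- lower entries `m - i` and `suc i` is then reached twice, with weights `suc i` and `m - i`, which
-- add up to `suc m`.
binom-vandermonde : ∀ x y m →
  binom (x ℚ.+ y) m ≡ ∑[ i ≤ m ] (binom x (m ∸ toℕ i) * binom y (toℕ i))
binom-vandermonde x y zero    = refl
binom-vandermonde x y (suc m) = fromℕ-cancelˡ m (begin
  m₁ * binom (x ℚ.+ y) (suc m)
    ≡⟨ binom-suc (x ℚ.+ y) m ⟩
  w * binom (x ℚ.+ y) m
    ≡⟨ cong (w *_) (binom-vandermonde x y m) ⟩
  w * ∑[ i ≤ m ] t (toℕ i)
    ≡⟨ *-distribˡ-sum {suc m} w (λ i → t (toℕ i)) ⟩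
  ∑[ i ≤ m ] (w * t (toℕ i))
    ≡⟨ sum-cong-< (suc m) (λ i i≤m → split i (s≤s⁻¹ i≤m)) ⟩
  ∑[ i ≤ m ] (f (toℕ i) ℚ.+ g (toℕ i))
    ≡⟨ sum-shift f g m g-above ⟩
  g 0 ℚ.+ ∑[ i ≤ m ] (f (toℕ i) ℚ.+ g (suc (toℕ i)))
    ≡⟨ cong (g 0 ℚ.+_) (sum-cong-< (suc m) (λ i i≤m → join i (s≤s⁻¹ i≤m))) ⟩
  ∑[ i ≤ suc m ] (m₁ * t′ (toℕ i))
    ≡⟨ *-distribˡ-sum {suc (suc m)} m₁ (λ i → t′ (toℕ i)) ⟨
  m₁ * ∑[ i ≤ suc m ] t′ (toℕ i) ∎)
  where
  m₁ = fromℕ (suc m)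
  w  = x ℚ.+ y - fromℕ m
  t t′ f g : ℕ → ℚ
  t  i = binom x (m ∸ i) * binom y i
  t′ i = binom x (suc m ∸ i) * binom y i
  f i = fromℕ (suc i) * (binom x (m ∸ i) * binom y (suc i))
  g i = fromℕ (suc m ∸ i) * t′ i

  m≡ : ∀ i → i ≤ m → fromℕ m ≡ fromℕ (m ∸ i) ℚ.+ fromℕ i
  m≡ i i≤m = trans (cong fromℕ (sym (ℕ.m∸n+n≡m i≤m))) (fromℕ-homo-+ (m ∸ i) i)

  g-above : g (suc m) ≡ 0ℚ
  g-above = trans (cong (λ k → fromℕ k * t′ (suc m)) (ℕ.n∸n≡0 m)) (ℚ.*-zeroˡ (t′ (suc m)))

  split : ∀ i → i ≤ m → w * t i ≡ f i ℚ.+ g i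
  split i i≤m = begin
    w * t i
      ≡⟨ cong (λ p → (x ℚ.+ y - p) * t i) (m≡ i i≤m) ⟩
    (x ℚ.+ y - (fromℕ (m ∸ i) ℚ.+ fromℕ i)) * t i
      ≡⟨ solve 6 (λ x y d i b c → (x :+ y :- (d :+ i)) :* (b :* c) :=
                   b :* ((y :- i) :* c) :+ ((x :- d) :* b) :* c) refl
           x y (fromℕ (m ∸ i)) (fromℕ i) (binom x (m ∸ i)) (binom y i) ⟩
    binom x (m ∸ i) * ((y - fromℕ i) * binom y i) ℚ.+
      ((x - fromℕ (m ∸ i)) * binom x (m ∸ i)) * binom y i
      ≡⟨ cong₂ (λ p q → binom x (m ∸ i) * p ℚ.+ q * binom y i)
           (binom-suc y i) (binom-suc x (m ∸ i)) ⟨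
    binom x (m ∸ i) * (fromℕ (suc i) * binom y (suc i)) ℚ.+
      (fromℕ (suc (m ∸ i)) * binom x (suc (m ∸ i))) * binom y i
      ≡⟨ cong (λ k → binom x (m ∸ i) * (fromℕ (suc i) * binom y (suc i)) ℚ.+
           (fromℕ k * binom x k) * binom y i) (ℕ.+-∸-assoc 1 i≤m) ⟨
    binom x (m ∸ i) * (fromℕ (suc i) * binom y (suc i)) ℚ.+
      (fromℕ (suc m ∸ i) * binom x (suc m ∸ i)) * binom y i
      ≡⟨ solve 6 (λ a b c d e h → a :* (b :* c) :+ (d :* e) :* h := b :* (a :* c) :+ d :* (e :* h)) refl
           (binom x (m ∸ i)) (fromℕ (suc i)) (binom y (suc i))
           (fromℕ (suc m ∸ i)) (binom x (suc m ∸ i)) (binom y i) ⟩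
    f i ℚ.+ g i ∎

  join : ∀ i → i ≤ m → f i ℚ.+ g (suc i) ≡ m₁ * t′ (suc i)
  join i i≤m = begin
    f i ℚ.+ g (suc i)
      ≡⟨ ℚ.*-distribʳ-+ (t′ (suc i)) (fromℕ (suc i)) (fromℕ (m ∸ i)) ⟨
    (fromℕ (suc i) ℚ.+ fromℕ (m ∸ i)) * t′ (suc i)
      ≡⟨ cong (_* t′ (suc i)) (fromℕ-homo-+ (suc i) (m ∸ i)) ⟨
    fromℕ (suc (i + (m ∸ i))) * t′ (suc i)
      ≡⟨ cong (λ k → fromℕ (suc k) * t′ (suc i)) (ℕ.m+[n∸m]≡n i≤m) ⟩
    m₁ * t′ (suc i) ∎

-- The sum has to start at `r = 0`, since for `j = 0` that term need not vanish. It disappears only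
-- after the sum over `j` is taken.
binom-reproducing : ∀ n k j → j ≤ k →
  binom (fromℕ (n + k)) (k + j) ≡
  ∑[ r ≤ k ] (binom (fromℕ k - fromℕ n) (k ∸ toℕ r) * binom (fromℕ (k + n)) (k + toℕ r) *
              binom (fromℕ (k + toℕ r)) (k + j))
binom-reproducing n k j j≤k = sym (begin
  ∑[ r ≤ k ] h (toℕ r)
    ≡⟨ cong (λ m → ∑[ r < m ] h (toℕ r)) 1+k≡j+1+d ⟩
  ∑[ r < j + suc d ] h (toℕ r)
    -- For `r < j` the factor `binom (k + r) (k + j)` is zero, so `r = j + i` with `i` from 0 to
    -- `d = k - j`.
    ≡⟨ sum-drop h j (suc d) h-below ⟩
  ∑[ i ≤ d ] h (j + toℕ i)
    ≡⟨ sum-cong-≗ {suc d} (λ i → split (toℕ i)) ⟩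
  ∑[ i ≤ d ] (B * (binom x (d ∸ toℕ i) * binom y (toℕ i)))
    ≡⟨ *-distribˡ-sum {suc d} B (λ i → binom x (d ∸ toℕ i) * binom y (toℕ i)) ⟨
  B * ∑[ i ≤ d ] (binom x (d ∸ toℕ i) * binom y (toℕ i))
    ≡⟨ cong (B *_) (binom-vandermonde x y d) ⟨
  B * binom (x ℚ.+ y) d
    -- `(k - n) + ((k + n) - (k + j)) = k - j`: the dependence on `n` cancels.
    ≡⟨ cong (λ p → B * binom p d) x+y≡d ⟩
  B * binom (fromℕ d) d
    ≡⟨ cong (B *_) (binom-diag d) ⟩
  B * 1ℚ
    ≡⟨ ℚ.*-identityʳ B ⟩
  B
    ≡⟨ cong (λ m → binom (fromℕ m) (k + j)) (ℕ.+-comm k n) ⟩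
  binom (fromℕ (n + k)) (k + j) ∎)
  where
  d = k ∸ j
  x = fromℕ k - fromℕ n
  y = fromℕ (k + n) - fromℕ (k + j)
  B = binom (fromℕ (k + n)) (k + j)
  h : ℕ → ℚ
  h r = binom x (k ∸ r) * binom (fromℕ (k + n)) (k + r) * binom (fromℕ (k + r)) (k + j)

  1+k≡j+1+d : suc k ≡ j + suc d
  1+k≡j+1+d = sym (trans (ℕ.+-suc j d) (cong suc (ℕ.m+[n∸m]≡n j≤k)))

  h-below : ∀ r → r < j → h r ≡ 0ℚ
  h-below r r<j = trans (cong (c *_) (binom-above (ℕ.+-monoʳ-< k r<j))) (ℚ.*-zeroʳ c)
    where c = binom x (k ∸ r) * binom (fromℕ (k + n)) (k + r)

  split : ∀ i → h (j + i) ≡ B * (binom x (d ∸ i) * binom y i)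
  split i = begin
    h (j + i)
      ≡⟨ cong₂ (λ p q → binom x p * binom (fromℕ (k + n)) q * binom (fromℕ q) (k + j))
           (sym (ℕ.∸-+-assoc k j i)) (sym (ℕ.+-assoc k j i)) ⟩
    binom x (d ∸ i) * binom (fromℕ (k + n)) (k + j + i) * binom (fromℕ (k + j + i)) (k + j)
      ≡⟨ ℚ.*-assoc (binom x (d ∸ i)) _ _ ⟩
    binom x (d ∸ i) * (binom (fromℕ (k + n)) (k + j + i) * binom (fromℕ (k + j + i)) (k + j))
      ≡⟨ cong (binom x (d ∸ i) *_) (binom-trinomial (fromℕ (k + n)) (k + j) i) ⟩
    binom x (d ∸ i) * (B * binom y i)
      ≡⟨ solve 3 (λ a b c → a :* (b :* c) := b :* (a :* c)) refl (binom x (d ∸ i)) B (binom y i) ⟩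
    B * (binom x (d ∸ i) * binom y i) ∎

  x+y≡d : x ℚ.+ y ≡ fromℕ d
  x+y≡d = begin
    fromℕ k - fromℕ n ℚ.+ (fromℕ (k + n) - fromℕ (k + j))
      ≡⟨ cong₂ (λ p q → fromℕ k - fromℕ n ℚ.+ (p - q)) (fromℕ-homo-+ k n) (fromℕ-homo-+ k j) ⟩
    fromℕ k - fromℕ n ℚ.+ (fromℕ k ℚ.+ fromℕ n - (fromℕ k ℚ.+ fromℕ j))
      ≡⟨ solve 3 (λ k n j → k :- n :+ (k :+ n :- (k :+ j)) := k :- j) refl (fromℕ k) (fromℕ n) (fromℕ j) ⟩
    fromℕ k - fromℕ j
      ≡⟨ cong (λ m → fromℕ m - fromℕ j) (ℕ.m∸n+n≡m j≤k) ⟨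
    fromℕ (d + j) - fromℕ j
      ≡⟨ cong (_- fromℕ j) (fromℕ-homo-+ d j) ⟩
    fromℕ d ℚ.+ fromℕ j - fromℕ j
      ≡⟨ solve 2 (λ d j → d :+ j :- j := d) refl (fromℕ d) (fromℕ j) ⟩
    fromℕ d ∎

-- Expansion of a triangular array in binomial coefficients.

-- Both kinds of Stirling numbers at once: w n k is n for the first kind and k + 1 for the
-- second, and e k is k and 0 respectively.
module Triangular
  (T w : ℕ → ℕ → ℚ) (e : ℕ → ℚ)
  (T-zero-zero : T 0 0 ≡ 1ℚ)
  (T-zero-suc : ∀ k → T 0 (suc k) ≡ 0ℚ)
  (T-suc-zero : ∀ n → T (suc n) 0 ≡ e n * T n 0)
  (T-suc-suc : ∀ n k → T (suc n) (suc k) ≡ T n k ℚ.+ w n k * T n (suc k))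
  (w-diag : ∀ n k → w (suc n + k) n ≡ fromℕ (suc n) ℚ.+ e k)
  (e-zero : e 0 ≡ 0ℚ)
  where

  T-above : ∀ {n k} → n < k → T n k ≡ 0ℚ
  T-above {zero}  {suc k} _         = T-zero-suc k
  T-above {suc n} {suc k} (s≤s n<k) = begin
    T (suc n) (suc k)                ≡⟨ T-suc-suc n k ⟩
    T n k ℚ.+ w n k * T n (suc k)
      ≡⟨ cong₂ (λ p q → p ℚ.+ w n k * q) (T-above n<k) (T-above (ℕ.m<n⇒m<1+n n<k)) ⟩
    0ℚ ℚ.+ w n k * 0ℚ                ≡⟨ trans (ℚ.+-identityˡ (w n k * 0ℚ)) (ℚ.*-zeroʳ (w n k)) ⟩
    0ℚ                               ∎

  T-diag : ∀ n → T n n ≡ 1ℚ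
  T-diag zero    = T-zero-zero
  T-diag (suc n) = begin
    T (suc n) (suc n)                ≡⟨ T-suc-suc n n ⟩
    T n n ℚ.+ w n n * T n (suc n)
      ≡⟨ cong₂ (λ p q → p ℚ.+ w n n * q) (T-diag n) (T-above (ℕ.n<1+n n)) ⟩
    1ℚ ℚ.+ w n n * 0ℚ                ≡⟨ cong (1ℚ ℚ.+_) (ℚ.*-zeroʳ (w n n)) ⟩
    1ℚ                               ∎

  -- The factor `e 0` kills the first entry below the top, and the recurrence passes the zero on.
  T-column-zero : ∀ n → T (suc n) 0 ≡ 0ℚ
  T-column-zero zero    =
    trans (T-suc-zero 0) (trans (cong (_* T 0 0) e-zero) (ℚ.*-zeroˡ (T 0 0)))
  T-column-zero (suc n) =
    trans (T-suc-zero (suc n)) (trans (cong (e (suc n) *_) (T-column-zero n)) (ℚ.*-zeroʳ (e (suc n))))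

  -- These are the associated Stirling numbers. For `e k = 0`, `coeff k j` counts the partitions of
  -- `k + j` elements into `j` blocks of size at least 2; for `e k = k`, the permutations of `k + j`
  -- elements with `j` cycles and no fixed point.
  coeff : ℕ → ℕ → ℚ
  coeff zero    zero    = 1ℚ
  coeff zero    (suc j) = 0ℚ
  coeff (suc k) zero    = e k * coeff k zero
  coeff (suc k) (suc j) =
    fromℕ (suc (k + j)) * coeff k j ℚ.+ (fromℕ (suc j) ℚ.+ e k) * coeff k (suc j)

  coeff-above : ∀ {k j} → k < j → coeff k j ≡ 0ℚ
  coeff-above {zero}  {suc j} _         = refl
  coeff-above {suc k} {suc j} (s≤s k<j) = begin
    a * coeff k j ℚ.+ b * coeff k (suc j)
      ≡⟨ cong₂ (λ p q → a * p ℚ.+ b * q) (coeff-above k<j) (coeff-above (ℕ.m<n⇒m<1+n k<j)) ⟩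
    a * 0ℚ ℚ.+ b * 0ℚ   ≡⟨ cong₂ ℚ._+_ (ℚ.*-zeroʳ a) (ℚ.*-zeroʳ b) ⟩
    0ℚ                  ∎
    where
    a = fromℕ (suc (k + j))
    b = fromℕ (suc j) ℚ.+ e k

  coeff-column-zero : ∀ k → coeff k 0 ≡ T k 0
  coeff-column-zero zero    = sym T-zero-zero
  coeff-column-zero (suc k) = trans (cong (e k *_) (coeff-column-zero k)) (sym (T-suc-zero k))

  -- Induction on `k` and, inside it, on `n`. The two terms of the recurrence for `T` expand with
  -- the same coefficients in `binom N (suc k + j)` and `binom N (k + j)`, and Pascal's rule adds
  -- these up.
  T-expansion : ∀ k n → T (n + k) n ≡ ∑[ j ≤ k ] (coeff k (toℕ j) * binom (fromℕ (n + k)) (k + toℕ j))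
  T-expansion zero n = trans (cong (λ m → T m n) (ℕ.+-identityʳ n)) (T-diag n)
  T-expansion (suc k) zero = begin
    T (suc k) 0
      ≡⟨ coeff-column-zero (suc k) ⟨
    c
      ≡⟨ solve 1 (λ c → c := c :* con 1ℚ :+ con 0ℚ) refl c ⟩
    c * 1ℚ ℚ.+ 0ℚ
      -- At `n = 0` only `j = 0` survives, because for larger `j` the lower entry `suc k + j`
      -- exceeds the upper entry `suc k`.
      ≡⟨ cong₂ (λ p q → c * p ℚ.+ q)
           (trans (cong (binom (fromℕ (suc k))) (ℕ.+-identityʳ (suc k))) (binom-diag (suc k)))
           (sum-zero {λ j → t (suc j)} (suc k) (λ j _ →
             trans (cong (coeff (suc k) (suc j) *_) (binom-above (ℕ.m<m+n (suc k) (s≤s z≤n))))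
                   (ℚ.*-zeroʳ (coeff (suc k) (suc j))))) ⟨
    ∑[ j ≤ suc k ] t (toℕ j) ∎
    where
    c = coeff (suc k) 0
    t : ℕ → ℚ
    t j = coeff (suc k) j * binom (fromℕ (suc k)) (suc k + j)
  T-expansion (suc k) (suc n) = begin
    T (suc (n + suc k)) (suc n)
      ≡⟨ T-suc-suc (n + suc k) n ⟩
    T (n + suc k) n ℚ.+ w (n + suc k) n * T (n + suc k) (suc n)
      ≡⟨ cong₂ ℚ._+_ (T-expansion (suc k) n) lower ⟩
    ∑[ j ≤ suc k ] (c (toℕ j) * binom N (suc k + toℕ j)) ℚ.+ ∑[ j ≤ suc k ] (c (toℕ j) * binom N (k + toℕ j))
      ≡⟨ ∑-distrib-+ {suc (suc k)} (λ j → c (toℕ j) * binom N (suc k + toℕ j)) (λ j → c (toℕ j) * binom N (k + toℕ j)) ⟨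
    ∑[ j ≤ suc k ] (c (toℕ j) * binom N (suc k + toℕ j) ℚ.+ c (toℕ j) * binom N (k + toℕ j))
      ≡⟨ sum-cong-≗ {suc (suc k)} (λ j → pascal (toℕ j)) ⟩
    ∑[ j ≤ suc k ] (c (toℕ j) * binom (fromℕ (suc n + suc k)) (suc k + toℕ j)) ∎
    where
    N = fromℕ (n + suc k)
    v = fromℕ (suc n) ℚ.+ e k
    c f g : ℕ → ℚ
    c = coeff (suc k)
    f j = fromℕ (suc (k + j)) * coeff k j * binom N (suc (k + j))
    g j = (fromℕ j ℚ.+ e k) * coeff k j * binom N (k + j)

    pascal : ∀ j → c j * binom N (suc k + j) ℚ.+ c j * binom N (k + j) ≡
                   c j * binom (fromℕ (suc n + suc k)) (suc k + j)
    pascal j = begin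
      c j * binom N (suc k + j) ℚ.+ c j * binom N (k + j)
        ≡⟨ solve 3 (λ c a b → c :* a :+ c :* b := c :* (b :+ a)) refl
             (c j) (binom N (suc k + j)) (binom N (k + j)) ⟩
      c j * (binom N (k + j) ℚ.+ binom N (suc k + j))
        ≡⟨ cong (c j *_) (binom-pascal N (k + j)) ⟨
      c j * binom (1ℚ ℚ.+ N) (suc (k + j))
        ≡⟨ cong (λ p → c j * binom p (suc (k + j))) (fromℕ-homo-+ 1 (n + suc k)) ⟨
      c j * binom (fromℕ (suc n + suc k)) (suc k + j) ∎

    N≡ : N ≡ 1ℚ ℚ.+ (fromℕ n ℚ.+ fromℕ k)
    N≡ = trans (cong fromℕ (ℕ.+-suc n k))
      (trans (fromℕ-homo-+ 1 (n + k)) (cong (1ℚ ℚ.+_) (fromℕ-homo-+ n k)))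

    -- The reason for the recurrence of `coeff`: as `N = suc n + k`, the weight `v = suc n + e k` is
    -- `(N - (k + j)) + (j + e k)`. The first part raises the lower entry of the binomial by
    -- `binom-suc`, the second leaves it unchanged.
    split : ∀ j → v * (coeff k j * binom N (k + j)) ≡ f j ℚ.+ g j
    split j = begin
      v * (coeff k j * b)
        ≡⟨ cong (λ p → (p ℚ.+ e k) * (coeff k j * b)) (fromℕ-homo-+ 1 n) ⟩
      (1ℚ ℚ.+ fromℕ n ℚ.+ e k) * (coeff k j * b)
        ≡⟨ solve 6 (λ n k j e c b → (con 1ℚ :+ n :+ e) :* (c :* b) :=
             c :* ((con 1ℚ :+ (n :+ k) :- (k :+ j)) :* b) :+ (j :+ e) :* c :* b) refl
             (fromℕ n) (fromℕ k) (fromℕ j) (e k) (coeff k j) b ⟩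
      coeff k j * ((1ℚ ℚ.+ (fromℕ n ℚ.+ fromℕ k) - (fromℕ k ℚ.+ fromℕ j)) * b) ℚ.+ g j
        ≡⟨ cong₂ (λ p q → coeff k j * ((p - q) * b) ℚ.+ g j) N≡ (fromℕ-homo-+ k j) ⟨
      coeff k j * ((N - fromℕ (k + j)) * b) ℚ.+ g j
        ≡⟨ cong (λ p → coeff k j * p ℚ.+ g j) (binom-suc N (k + j)) ⟨
      coeff k j * (fromℕ (suc (k + j)) * binom N (suc (k + j))) ℚ.+ g j
        ≡⟨ cong (ℚ._+ g j) (solve 3 (λ a b c → a :* (b :* c) := b :* a :* c) refl
             (coeff k j) (fromℕ (suc (k + j))) (binom N (suc (k + j)))) ⟩
      f j ℚ.+ g j ∎
      where b = binom N (k + j)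

    g-above : g (suc k) ≡ 0ℚ
    g-above = begin
      p * coeff k (suc k) * q  ≡⟨ cong (λ z → p * z * q) (coeff-above (ℕ.n<1+n k)) ⟩
      p * 0ℚ * q               ≡⟨ solve 2 (λ p q → p :* con 0ℚ :* q := con 0ℚ) refl p q ⟩
      0ℚ                       ∎
      where
      p = fromℕ (suc k) ℚ.+ e k
      q = binom N (k + suc k)

    g-zero : g 0 ≡ c 0 * binom N (k + 0)
    g-zero = cong (λ p → p * coeff k 0 * binom N (k + 0)) (ℚ.+-identityˡ (e k))

    join : ∀ j → f j ℚ.+ g (suc j) ≡ c (suc j) * binom N (k + suc j)
    join j = begin
      f j ℚ.+ g (suc j)
        ≡⟨ cong (λ m → a * binom N m ℚ.+ g (suc j)) (ℕ.+-suc k j) ⟨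
      a * binom N (k + suc j) ℚ.+ g (suc j)
        ≡⟨ ℚ.*-distribʳ-+ (binom N (k + suc j)) a ((fromℕ (suc j) ℚ.+ e k) * coeff k (suc j)) ⟨
      c (suc j) * binom N (k + suc j) ∎
      where a = fromℕ (suc (k + j)) * coeff k j

    lower : w (n + suc k) n * T (n + suc k) (suc n) ≡ ∑[ j ≤ suc k ] (c (toℕ j) * binom N (k + toℕ j))
    lower = begin
      w (n + suc k) n * T (n + suc k) (suc n)
        -- Reading `n + suc k` as `suc n + k` gives an entry covered by the induction hypothesis for
        -- `k`, with weight known from `w-diag`.
        ≡⟨ cong₂ (λ p q → p * T q (suc n))
             (trans (cong (λ m → w m n) (ℕ.+-suc n k)) (w-diag n k)) (ℕ.+-suc n k) ⟩
      v * T (suc n + k) (suc n)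
        ≡⟨ cong (v *_) (T-expansion k (suc n)) ⟩
      v * ∑[ j ≤ k ] (coeff k (toℕ j) * binom (fromℕ (suc n + k)) (k + toℕ j))
        ≡⟨ cong (λ m → v * ∑[ j ≤ k ] (coeff k (toℕ j) * binom (fromℕ m) (k + toℕ j))) (ℕ.+-suc n k) ⟨
      v * ∑[ j ≤ k ] (coeff k (toℕ j) * binom N (k + toℕ j))
        ≡⟨ *-distribˡ-sum {suc k} v (λ j → coeff k (toℕ j) * binom N (k + toℕ j)) ⟩
      ∑[ j ≤ k ] (v * (coeff k (toℕ j) * binom N (k + toℕ j)))
        ≡⟨ sum-cong-≗ {suc k} (λ j → split (toℕ j)) ⟩
      ∑[ j ≤ k ] (f (toℕ j) ℚ.+ g (toℕ j))
        ≡⟨ sum-shift f g k g-above ⟩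
      g 0 ℚ.+ ∑[ j ≤ k ] (f (toℕ j) ℚ.+ g (suc (toℕ j)))
        ≡⟨ cong₂ ℚ._+_ g-zero (sum-cong-≗ {suc k} (λ j → join (toℕ j))) ⟩
      ∑[ j ≤ suc k ] (c (toℕ j) * binom N (k + toℕ j)) ∎

  T-reproducing : ∀ k n .{{_ : NonZero k}} → T (n + k) n ≡ ∑[ i < k ] (let r = suc (toℕ i) in
    binom (fromℕ k - fromℕ n) (k ∸ r) * binom (fromℕ (k + n)) (k + r) * T (k + r) r)
  T-reproducing k@(suc k-1) n = begin
    T (n + k) n
      ≡⟨ T-expansion k n ⟩
    ∑[ j ≤ k ] (a (toℕ j) * binom (fromℕ (n + k)) (k + toℕ j))
      ≡⟨ sum-cong-< (suc k) expand ⟩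
    ∑[ j ≤ k ] ∑[ r ≤ k ] t (toℕ j) (toℕ r)
      -- For fixed `r` the inner sum over `j` is the expansion of `T (r + k) r`, since the
      -- coefficients are the same for every `n`.
      ≡⟨ ∑-comm {suc k} {suc k} (λ j r → t (toℕ j) (toℕ r)) ⟩
    ∑[ r ≤ k ] ∑[ j ≤ k ] t (toℕ j) (toℕ r)
      ≡⟨ sum-cong-≗ {suc k} (λ r → collect (toℕ r)) ⟩
    W 0 * T (k + 0) 0 ℚ.+ ∑[ i < k ] (W (suc (toℕ i)) * T (k + suc (toℕ i)) (suc (toℕ i)))
      -- The term `r = 0` vanishes because `k` is positive and so `T k 0` is zero.
      ≡⟨ cong (ℚ._+ ∑[ i < k ] (W (suc (toℕ i)) * T (k + suc (toℕ i)) (suc (toℕ i))))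
           (trans (cong (W 0 *_) (T-column-zero (k-1 + 0))) (ℚ.*-zeroʳ (W 0))) ⟩
    0ℚ ℚ.+ ∑[ i < k ] (W (suc (toℕ i)) * T (k + suc (toℕ i)) (suc (toℕ i)))
      ≡⟨ ℚ.+-identityˡ _ ⟩
    ∑[ i < k ] (W (suc (toℕ i)) * T (k + suc (toℕ i)) (suc (toℕ i))) ∎
    where
    a W : ℕ → ℚ
    a = coeff k
    W r = binom (fromℕ k - fromℕ n) (k ∸ r) * binom (fromℕ (k + n)) (k + r)
    t : ℕ → ℕ → ℚ
    t j r = a j * (W r * binom (fromℕ (k + r)) (k + j))

    expand : ∀ j → j < suc k → a j * binom (fromℕ (n + k)) (k + j) ≡ ∑[ r ≤ k ] t j (toℕ r)
    expand j j≤k = trans (cong (a j *_) (binom-reproducing n k j (s≤s⁻¹ j≤k)))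
      (*-distribˡ-sum {suc k} (a j) (λ r → W (toℕ r) * binom (fromℕ (k + toℕ r)) (k + j)))

    collect : ∀ r → ∑[ j ≤ k ] t (toℕ j) r ≡ W r * T (k + r) r
    collect r = begin
      ∑[ j ≤ k ] t (toℕ j) r
        ≡⟨ sum-cong-≗ {suc k} (λ j → solve 3 (λ a b c → a :* (b :* c) := b :* (a :* c)) refl
             (a (toℕ j)) (W r) (binom (fromℕ (k + r)) (k + toℕ j))) ⟩
      ∑[ j ≤ k ] (W r * (a (toℕ j) * binom (fromℕ (k + r)) (k + toℕ j)))
        ≡⟨ *-distribˡ-sum {suc k} (W r) (λ j → a (toℕ j) * binom (fromℕ (k + r)) (k + toℕ j)) ⟨
      W r * ∑[ j ≤ k ] (a (toℕ j) * binom (fromℕ (k + r)) (k + toℕ j))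
        ≡⟨ cong (λ m → W r * ∑[ j ≤ k ] (a (toℕ j) * binom (fromℕ m) (k + toℕ j))) (ℕ.+-comm k r) ⟩
      W r * ∑[ j ≤ k ] (a (toℕ j) * binom (fromℕ (r + k)) (k + toℕ j))
        ≡⟨ cong (W r *_) (T-expansion k r) ⟨
      W r * T (r + k) r
        ≡⟨ cong (λ m → W r * T m r) (ℕ.+-comm r k) ⟩
      W r * T (k + r) r ∎

-- Uniqueness of coefficients.

-- Two expansions in a family φ with φ₀ = 1 that agree at all nodes have equal coefficients,
-- provided shifting the node lowers the degree; this covers both bases, x ^ k at the
-- nodes 2 ^ i and falling x k at the nodes i.
module _
  (φ : ℕ → ℕ → ℚ) (μ ρ : ℕ → ℚ)
  (φ-zero : ∀ i → φ 0 i ≡ 1ℚ)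
  (φ-shift : ∀ k i → φ (suc k) (suc i) ≡ φ (suc k) i ℚ.+ ρ i * (μ k * φ k i))
  (μ≢0 : ∀ k → μ k ≢ 0ℚ)
  (ρ≢0 : ∀ i → ρ i ≢ 0ℚ)
  where

  expansion : (ℕ → ℚ) → ℕ → ℕ → ℚ
  expansion a n i = ∑[ k < n ] (a (toℕ k) * φ (toℕ k) i)

  -- Coefficients of the difference between the values at nodes `suc i` and `i`, divided by `ρ i`.
  derive : (ℕ → ℚ) → ℕ → ℚ
  derive a k = a (suc k) * μ k

  expansion-shift : ∀ a n i →
    expansion a (suc n) (suc i) ≡ expansion a (suc n) i ℚ.+ ρ i * expansion (derive a) n i
  expansion-shift a n i = begin
    a 0 * φ 0 (suc i) ℚ.+ ∑[ k < n ] (a (suc (toℕ k)) * φ (suc (toℕ k)) (suc i))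
      ≡⟨ cong₂ (λ p q → a 0 * p ℚ.+ q) (trans (φ-zero (suc i)) (sym (φ-zero i)))
           (sum-cong-≗ {n} (λ k → step (toℕ k))) ⟩
    a 0 * φ 0 i ℚ.+ ∑[ k < n ] (f (toℕ k) ℚ.+ ρ i * g (toℕ k))
      ≡⟨ cong (a 0 * φ 0 i ℚ.+_) (∑-distrib-+ {n} (λ k → f (toℕ k)) (λ k → ρ i * g (toℕ k))) ⟩
    a 0 * φ 0 i ℚ.+ (F ℚ.+ ∑[ k < n ] (ρ i * g (toℕ k)))
      ≡⟨ cong (λ p → a 0 * φ 0 i ℚ.+ (F ℚ.+ p)) (*-distribˡ-sum {n} (ρ i) (λ k → g (toℕ k))) ⟨
    a 0 * φ 0 i ℚ.+ (F ℚ.+ ρ i * expansion (derive a) n i)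
      ≡⟨ ℚ.+-assoc (a 0 * φ 0 i) F (ρ i * expansion (derive a) n i) ⟨
    a 0 * φ 0 i ℚ.+ F ℚ.+ ρ i * expansion (derive a) n i ∎
    where
    f g : ℕ → ℚ
    f k = a (suc k) * φ (suc k) i
    g k = derive a k * φ k i
    F = ∑[ k < n ] f (toℕ k)
    step : ∀ k → a (suc k) * φ (suc k) (suc i) ≡ f k ℚ.+ ρ i * g k
    step k = trans (cong (a (suc k) *_) (φ-shift k i))
      (solve 5 (λ a p r m q → a :* (p :+ r :* (m :* q)) := a :* p :+ r :* (a :* m :* q)) refl
        (a (suc k)) (φ (suc k) i) (ρ i) (μ k) (φ k i))

  -- Induction on the number of terms: differences at consecutive nodes agree as well, and after
  -- cancelling `ρ i` they are expansions with one term fewer. This settles all coefficients except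
  -- the constant one.
  expansion-injective : ∀ n a b → (∀ i → expansion a n i ≡ expansion b n i) →
    ∀ k → k < n → a k ≡ b k
  expansion-injective (suc n) a b a≗b = go
    where
    derive≗ : ∀ i → expansion (derive a) n i ≡ expansion (derive b) n i
    derive≗ i = *-cancelˡ-≢0 (ρ≢0 i) (+-cancelˡ (expansion a (suc n) i) _ _ (begin
      expansion a (suc n) i ℚ.+ ρ i * expansion (derive a) n i  ≡⟨ expansion-shift a n i ⟨
      expansion a (suc n) (suc i)                               ≡⟨ a≗b (suc i) ⟩
      expansion b (suc n) (suc i)                               ≡⟨ expansion-shift b n i ⟩
      expansion b (suc n) i ℚ.+ ρ i * expansion (derive b) n i
        ≡⟨ cong (ℚ._+ ρ i * expansion (derive b) n i) (a≗b i) ⟨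
      expansion a (suc n) i ℚ.+ ρ i * expansion (derive b) n i  ∎))

    tails : ∀ k → k < n → a (suc k) ≡ b (suc k)
    tails k k<n = *-cancelˡ-≢0 (μ≢0 k) (begin
      μ k * a (suc k)  ≡⟨ ℚ.*-comm (μ k) (a (suc k)) ⟩
      a (suc k) * μ k  ≡⟨ expansion-injective n (derive a) (derive b) derive≗ k k<n ⟩
      b (suc k) * μ k  ≡⟨ ℚ.*-comm (b (suc k)) (μ k) ⟩
      μ k * b (suc k)  ∎)

    head : a 0 ≡ b 0
    head = begin
      a 0          ≡⟨ ℚ.*-identityʳ (a 0) ⟨
      a 0 * 1ℚ     ≡⟨ cong (a 0 *_) (φ-zero 0) ⟨
      -- At node 0 the remaining terms of both expansions agree by `tails` and cancel.
      a 0 * φ 0 0  ≡⟨ +-cancelʳ (∑[ k < n ] (b (suc (toℕ k)) * φ (suc (toℕ k)) 0)) _ _ (trans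
                        (cong (a 0 * φ 0 0 ℚ.+_) (sum-cong-< n (λ k k<n →
                          cong (_* φ (suc k) 0) (sym (tails k k<n)))))
                        (a≗b 0)) ⟩
      b 0 * φ 0 0  ≡⟨ cong (b 0 *_) (φ-zero 0) ⟩
      b 0 * 1ℚ     ≡⟨ ℚ.*-identityʳ (b 0) ⟩
      b 0          ∎

    go : ∀ k → k < suc n → a k ≡ b k
    go zero    _         = head
    go (suc k) (s≤s k<n) = tails k k<n

-- The forward difference lowers falling factorials as the derivative lowers powers. At the nodes
-- `i` this is `φ-shift` with `ρ` constantly 1.
falling-shift : ∀ x k →
  falling (1ℚ ℚ.+ x) (suc k) ≡ falling x (suc k) ℚ.+ fromℕ (suc k) * falling x k
falling-shift x zero =
  solve 1 (λ x → con 1ℚ :* (con 1ℚ :+ x :- con 0ℚ) := con 1ℚ :* (x :- con 0ℚ) :+ con 1ℚ :* con 1ℚ) refl x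
falling-shift x (suc k) = begin
  falling (1ℚ ℚ.+ x) (suc k) * (1ℚ ℚ.+ x - fromℕ (suc k))
    ≡⟨ cong (_* (1ℚ ℚ.+ x - fromℕ (suc k))) (falling-shift x k) ⟩
  (u * (x - b) ℚ.+ fromℕ (suc k) * u) * (1ℚ ℚ.+ x - fromℕ (suc k))
    ≡⟨ cong (λ p → (u * (x - b) ℚ.+ p * u) * (1ℚ ℚ.+ x - p)) (fromℕ-homo-+ 1 k) ⟩
  (u * (x - b) ℚ.+ (1ℚ ℚ.+ b) * u) * (1ℚ ℚ.+ x - (1ℚ ℚ.+ b))
    ≡⟨ solve 3 (λ u x b →
         (u :* (x :- b) :+ (con 1ℚ :+ b) :* u) :* (con 1ℚ :+ x :- (con 1ℚ :+ b)) :=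
         u :* (x :- b) :* (x :- (con 1ℚ :+ b)) :+ (con 1ℚ :+ (con 1ℚ :+ b)) :* (u :* (x :- b)))
         refl u x b ⟩
  u * (x - b) * (x - (1ℚ ℚ.+ b)) ℚ.+ (1ℚ ℚ.+ (1ℚ ℚ.+ b)) * (u * (x - b))
    ≡⟨ cong₂ (λ p q → u * (x - b) * (x - p) ℚ.+ q * (u * (x - b)))
         (fromℕ-homo-+ 1 k) (trans (fromℕ-homo-+ 1 (suc k)) (cong (1ℚ ℚ.+_) (fromℕ-homo-+ 1 k))) ⟨
  falling x (suc (suc k)) ℚ.+ fromℕ (suc (suc k)) * falling x (suc k) ∎
  where
  b = fromℕ k
  u = falling x k

falling-coefficients-unique : ∀ {n} (a b : ℕ → ℚ) →
  (∀ x → ∑[ k < n ] (a (toℕ k) * falling x (toℕ k)) ≡ ∑[ k < n ] (b (toℕ k) * falling x (toℕ k))) →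
  ∀ k → k < n → a k ≡ b k
falling-coefficients-unique {n} a b a≗b = expansion-injective
  (λ k i → falling (fromℕ i) k) (λ k → fromℕ (suc k)) (λ _ → 1ℚ)
  (λ _ → refl) shift (λ k → fromℕ≢0 (suc k)) (λ _ → ℚ.1≢0) n a b (λ i → a≗b (fromℕ i))
  where
  shift : ∀ k i → falling (fromℕ (suc i)) (suc k) ≡
    falling (fromℕ i) (suc k) ℚ.+ 1ℚ * (fromℕ (suc k) * falling (fromℕ i) k)
  shift k i = trans (cong (λ p → falling p (suc k)) (fromℕ-homo-+ 1 i))
    (trans (falling-shift (fromℕ i) k)
      (cong (falling (fromℕ i) (suc k) ℚ.+_) (sym (ℚ.*-identityˡ (fromℕ (suc k) * falling (fromℕ i) k)))))

-- Needed for the factor `μ k` of the power basis to be nonzero. The witness comes from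
-- `2 * t - 1 = 1 + 2 * (t - 1)`.
2^[1+k]-1 : ∀ k → ∃[ m ] fromℕ 2 ^ suc k - 1ℚ ≡ fromℕ (suc m)
2^[1+k]-1 zero    = 0 , refl
2^[1+k]-1 (suc k) with m , eq ← 2^[1+k]-1 k = suc m + suc m , (begin
  fromℕ 2 * t - 1ℚ
    ≡⟨ solve 1 (λ t → con (fromℕ 2) :* t :- con 1ℚ := con 1ℚ :+ ((t :- con 1ℚ) :+ (t :- con 1ℚ))) refl t ⟩
  1ℚ ℚ.+ ((t - 1ℚ) ℚ.+ (t - 1ℚ))
    ≡⟨ cong (λ p → 1ℚ ℚ.+ (p ℚ.+ p)) eq ⟩
  1ℚ ℚ.+ (fromℕ (suc m) ℚ.+ fromℕ (suc m))
    ≡⟨ cong (1ℚ ℚ.+_) (fromℕ-homo-+ (suc m) (suc m)) ⟨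
  1ℚ ℚ.+ fromℕ (suc m + suc m)
    ≡⟨ fromℕ-homo-+ 1 (suc m + suc m) ⟨
  fromℕ (suc (suc m + suc m)) ∎)
  where t = fromℕ 2 ^ suc k

-- For powers the step from `x` to `1 + x` has no one-term difference, but the step from `x` to
-- `2 * x` does: it adds `(2 ^ suc k - 1) * x * x ^ k` to `x ^ suc k`. Hence the nodes `2 ^ i`, with
-- `ρ i = 2 ^ i`.
power-coefficients-unique : ∀ {n} (a b : ℕ → ℚ) →
  (∀ x → ∑[ k < n ] (a (toℕ k) * x ^ toℕ k) ≡ ∑[ k < n ] (b (toℕ k) * x ^ toℕ k)) →
  ∀ k → k < n → a k ≡ b k
power-coefficients-unique {n} a b a≗b = expansion-injective
  (λ k i → (two ^ i) ^ k) (λ k → two ^ suc k - 1ℚ) (two ^_)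
  (λ _ → refl) shift μ≢0 (^-≢0 (fromℕ≢0 2)) n a b (λ i → a≗b (two ^ i))
  where
  two = fromℕ 2

  shift : ∀ k i → (two ^ suc i) ^ suc k ≡
    (two ^ i) ^ suc k ℚ.+ two ^ i * ((two ^ suc k - 1ℚ) * (two ^ i) ^ k)
  shift k i = trans (^-distrib-* two (two ^ i) (suc k))
    (solve 3 (λ t x p → t :* (x :* p) := x :* p :+ x :* ((t :- con 1ℚ) :* p)) refl
      (two ^ suc k) (two ^ i) ((two ^ i) ^ k))

  μ≢0 : ∀ k → two ^ suc k - 1ℚ ≢ 0ℚ
  μ≢0 k μ≡0 with m , eq ← 2^[1+k]-1 k = fromℕ≢0 (suc m) (trans (sym eq) μ≡0)

IsStirling₁-unique : ∀ s t → IsStirling₁ s → IsStirling₁ t →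
  ∀ n k .{{_ : NonZero n}} → k ≤ n → s n k ≡ t n k
IsStirling₁-unique s t s-stirling t-stirling n k k≤n =
  *-cancelˡ-≢0 (^-≢0 { - 1ℚ} (λ ()) (n ∸ k))
    (power-coefficients-unique (λ j → (- 1ℚ) ^ (n ∸ j) * s n j) (λ j → (- 1ℚ) ^ (n ∸ j) * t n j)
      (λ x → trans (sym (s-stirling n x)) (t-stirling n x)) k (s≤s k≤n))

IsStirling₂-unique : ∀ S T → IsStirling₂ S → IsStirling₂ T →
  ∀ n k .{{_ : NonZero n}} → k ≤ n → S n k ≡ T n k
IsStirling₂-unique S T S-stirling T-stirling n k k≤n =
  falling-coefficients-unique (S n) (T n)
    (λ x → trans (sym (S-stirling n x)) (T-stirling n x)) k (s≤s k≤n)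

-- Transfer from the recurrences to arbitrary Stirling numbers.

stirling₁ stirling₂ : ℕ → ℕ → ℚ
stirling₁ = proj₁ stirling₁-exists
stirling₂ = proj₁ stirling₂-exists

-- The witnesses are defined by the triangular recurrences, so most parameters hold by computation.
module Stirling₁ = Triangular stirling₁ (λ n _ → fromℕ n) fromℕ
  refl (λ _ → refl) (λ _ → refl) (λ _ _ → refl) (λ n k → fromℕ-homo-+ (suc n) k) refl

module Stirling₂ = Triangular stirling₂ (λ _ k → fromℕ (suc k)) (λ _ → 0ℚ)
  refl (λ _ → refl) (λ n → sym (ℚ.*-zeroˡ (stirling₂ n 0))) (λ _ _ → refl)
  (λ n _ → sym (ℚ.+-identityʳ (fromℕ (suc n)))) refl

-- Every entry in the identity lies where the defining polynomial identities determine it: `n + k`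
-- and `k + r` are positive, `n ≤ n + k` and `r ≤ k + r`.
reproducing-transfer : ∀ (s t : ℕ → ℕ → ℚ) → (∀ n k .{{_ : NonZero n}} → k ≤ n → s n k ≡ t n k) →
  ∀ k n .{{_ : NonZero k}} (c : ℕ → ℚ) →
  t (n + k) n ≡ ∑[ i < k ] (c (suc (toℕ i)) * t (k + suc (toℕ i)) (suc (toℕ i))) →
  s (n + k) n ≡ ∑[ i < k ] (c (suc (toℕ i)) * s (k + suc (toℕ i)) (suc (toℕ i)))
reproducing-transfer s t s≗t k@(suc k-1) n c t-rep = begin
  s (n + k) n
    ≡⟨ s≗t (n + k) n {{ℕ.≢-nonZero (ℕ.m+1+n≢0 n)}} (ℕ.m≤m+n n k) ⟩
  t (n + k) n
    ≡⟨ t-rep ⟩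
  ∑[ i < k ] (c (suc (toℕ i)) * t (k + suc (toℕ i)) (suc (toℕ i)))
    ≡⟨ sum-cong-≗ {k} (λ i → cong (c (suc (toℕ i)) *_)
         (s≗t (k + suc (toℕ i)) (suc (toℕ i)) (ℕ.m≤n+m (suc (toℕ i)) k))) ⟨
  ∑[ i < k ] (c (suc (toℕ i)) * s (k + suc (toℕ i)) (suc (toℕ i))) ∎

theorem2p3 : (s S : ℕ → ℕ → ℚ) → IsStirling₁ s → IsStirling₂ S →
    (k n : ℕ) .{{_ : NonZero k}} .{{_ : NonZero n}} →
    (S (n + k) n ≡ ∑[ i < k ] (let r = suc (toℕ i) in
    binom (fromℕ k - fromℕ n) (k ∸ r) * binom (fromℕ (k + n)) (k + r) * S (k + r) r))
    ×
    (s (n + k) n ≡ ∑[ i < k ] (let r = suc (toℕ i) in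
    binom (fromℕ k - fromℕ n) (k ∸ r) * binom (fromℕ (k + n)) (k + r) * s (k + r) r))
theorem2p3 s S s-stirling S-stirling k n =
  reproducing-transfer S stirling₂ (IsStirling₂-unique S stirling₂ S-stirling (proj₂ stirling₂-exists)) k n weight
    (Stirling₂.T-reproducing k n) ,
  reproducing-transfer s stirling₁ (IsStirling₁-unique s stirling₁ s-stirling (proj₂ stirling₁-exists)) k n weight
    (Stirling₁.T-reproducing k n)
  where
  weight : ℕ → ℚ
  weight r = binom (fromℕ k - fromℕ n) (k ∸ r) * binom (fromℕ (k + n)) (k + r)
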